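{- For all connected graphs $G$ and $H$ on $n$ vertices, either $X_G-X_H=0$ or $X_G-X_H$ is not Schur-positive.
   Context: All graphs are finite and simple. The chromatic symmetric function of a graph $G$ with vertices $v_1,\dots,v_n$ is $X_G=\sum_{\kappa}x_{\kappa(v_1)}\cdots x_{\kappa(v_n)}$, summed over all proper colorings $\kappa:V(G)\to\{1,2,3,\dots\}$ (adjacent vertices get different colors); it is a homogeneous symmetric function of degree $n$ in commuting variables $x_1,x_2,\dots$ over $\mathbb{Q}$. A symmetric function is Schur-positive if it is a linear combination of Schur symmetric functions $s_\lambda$ with non-negative coefficients. -}

module Defs where

open import Data.Nat as ℕ using (ℕ; suc; zero)
import Data.Nat.Properties as ℕ
open import Data.Integer using (+_)
open import Data.Rational as ℚ using (ℚ; 0ℚ; _/_)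
open import Data.Fin as Fin using (Fin)
import Data.Fin.Properties as Fin
open import Data.List as List using (List; []; _∷_; length; filter; allFin; concat; cartesianProductWith)
open import Data.List.Relation.Unary.All as All using (All)
open import Data.List.Relation.Unary.Linked using (Linked; linked?)
open import Data.List.Relation.Binary.Prefix.Heterogeneous using (Prefix)
open import Data.List.Relation.Binary.Prefix.Heterogeneous.Properties using (prefix?)
open import Data.Vec as Vec using (Vec; []; _∷_; lookup; toList)
import Data.Vec.Properties as Vec
open import Data.Product using (_×_; _,_; ∃-syntax)
open import Level using (0ℓ)
open import Relation.Binary using (Rel; Decidable; Symmetric)
open import Relation.Binary.Construct.Closure.ReflexiveTransitive using (Star)
open import Relation.Binary.PropositionalEquality using (_≡_)
open import Relation.Nullary using (Dec; ¬_)
open import Relation.Nullary.Decidable using (¬?; _×-dec_; _→-dec_)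

record Graph (n : ℕ) : Set₁ where
  field
    Adj       : Rel (Fin n) 0ℓ
    adj?      : Decidable Adj
    symmetric : Symmetric Adj
    loopless  : ∀ v → ¬ Adj v v

Connected : ∀ {n} → Graph n → Set
Connected G = ∀ u v → Star (Graph.Adj G) u v

-- Formal power series over ℚ in the variables x₁, x₂, …, given by their
-- coefficients: F m (a₁ ∷ … ∷ aₘ ∷ []) is the coefficient of x₁^a₁ ⋯ xₘ^aₘ.
-- Every monomial involves finitely many variables, so some m reaches it.  Padding
-- an exponent vector with zeros names the same monomial again; X and schur below
-- give equal coefficients to all names of a monomial.
PowerSeries : Set
PowerSeries = ∀ m → Vec ℕ m → ℚ

infix  4 _≈ₛ_
infixl 6 _+ₛ_ _-ₛ_
infixr 7 _·ₛ_

_≈ₛ_ : PowerSeries → PowerSeries → Set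
F ≈ₛ H = ∀ m (α : Vec ℕ m) → F m α ≡ H m α

0ₛ : PowerSeries
0ₛ m α = 0ℚ

_+ₛ_ _-ₛ_ : PowerSeries → PowerSeries → PowerSeries
(F +ₛ H) m α = F m α ℚ.+ H m α
(F -ₛ H) m α = F m α ℚ.- H m α

_·ₛ_ : ℚ → PowerSeries → PowerSeries
(c ·ₛ F) m α = c ℚ.* F m α

-- All words of length k in the letters Fin m, each listed once.
words : ∀ m k → List (Vec (Fin m) k)
words m zero    = [] ∷ []
words m (suc k) = cartesianProductWith _∷_ (allFin m) (words m k)

-- The exponent vector of the product of the variables indexed by the list.
content : ∀ {m} → List (Fin m) → Vec ℕ m
content is = Vec.tabulate λ i → length (filter (i Fin.≟_) is)

HasContent : ∀ {m} → Vec ℕ m → List (Fin m) → Set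
HasContent α is = content is ≡ α

hasContent? : ∀ {m} (α : Vec ℕ m) is → Dec (HasContent α is)
hasContent? α is = Vec.≡-dec ℕ._≟_ (content is) α

Proper : ∀ {n m} → Graph n → Vec (Fin m) n → Set
Proper G κ = ∀ u v → Graph.Adj G u v → ¬ lookup κ u ≡ lookup κ v

proper? : ∀ {n m} (G : Graph n) (κ : Vec (Fin m) n) → Dec (Proper G κ)
proper? G κ = Fin.all? λ u → Fin.all? λ v →
  Graph.adj? G u v →-dec ¬? (lookup κ u Fin.≟ lookup κ v)

-- The colorings contributing to a monomial in x₁, …, xₘ use only the first m
-- colors, so the sum over all proper colorings is finite in each coefficient.
X : ∀ {n} → Graph n → PowerSeries
X {n} G m α = + length (filter contributes? (words m n)) / 1
  where
  contributes? : (κ : Vec (Fin m) n) → Dec (Proper G κ × HasContent α (toList κ))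
  contributes? κ = proper? G κ ×-dec hasContent? α (toList κ)

record Partition : Set where
  field
    parts      : List ℕ
    decreasing : Linked ℕ._≥_ parts
    positive   : All (0 ℕ.<_) parts

-- The list of rows, the longest (first) row on top.
Filling : ℕ → Set
Filling m = List (List (Fin m))

-- All fillings with the given row lengths, each listed once.
fillings : ∀ m → List ℕ → List (Filling m)
fillings m []       = [] ∷ []
fillings m (r ∷ rs) = cartesianProductWith (λ w T → toList w ∷ T) (words m r) (fillings m rs)

-- upper Above lower: the two rows being left-justified, each entry of the lower
-- row has an entry of the upper row directly above it, and exceeds it.
_Above_ : ∀ {m} → Rel (List (Fin m)) 0ℓ
upper Above lower = Prefix Fin._>_ lower upper

SemiStandard : ∀ {m} → Filling m → Set
SemiStandard T = All (Linked Fin._≤_) T × Linked _Above_ T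

semiStandard? : ∀ {m} (T : Filling m) → Dec (SemiStandard T)
semiStandard? T = All.all? (linked? Fin._≤?_) T
  ×-dec linked? (λ upper lower → prefix? (λ i j → j Fin.<? i) lower upper) T

-- The generating function of semistandard Young tableaux of shape p.
schur : Partition → PowerSeries
schur p m α = + length (filter contributes? (fillings m (Partition.parts p))) / 1
  where
  contributes? : (T : Filling m) → Dec (SemiStandard T × HasContent α (concat T))
  contributes? T = semiStandard? T ×-dec hasContent? α (concat T)

schurCombination : List (ℚ × Partition) → PowerSeries
schurCombination = List.foldr (λ (c , p) F → c ·ₛ schur p +ₛ F) 0ₛ

SchurPositive : PowerSeries → Set
SchurPositive F = ∃[ cs ] All (λ (c , _) → 0ℚ ℚ.≤ c) cs × F ≈ₛ schurCombination cs

-- The coefficient of x₁⋯x_d in X_G counts the bijective colorings, all of which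
-- are proper, so it does not depend on G.  In a Schur function s_λ with |λ| = d
-- the same coefficient is positive, because there is a standard tableau of shape
-- λ.  Hence these coefficients force every c_λ in a non-negative Schur expansion
-- of X_G - X_H to vanish.  Constructively, the dichotomy also needs X_G - X_H = 0
-- to be decidable: a monomial of degree n uses at most n variables and unused
-- variables can be deleted, so finitely many coefficients suffice.
module Submission where

open import Defs
open import Data.Nat using (ℕ; zero; suc; _≤_; _≥_; _<_; s≤s; _≤?_)
import Data.Nat.Base as ℕ
open import Data.Nat.ListAction using (sum)
open import Data.Nat.Properties
  using (≤-trans; ≤-reflexive; <⇒≤; n≤1+n; m≤m+n; m≤n⇒m⊓n≡m; ≰⇒>;
         m+n∸m≡n; n>0⇒n≢0; 1+n≰n; allUpTo?; _≟_; ≤-refl)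
open import Data.Integer using (+_)
open import Data.Rational using (ℚ; 0ℚ; _/_)
import Data.Rational as ℚ
import Data.Rational.Properties as ℚ
open import Data.Fin using (Fin; zero; suc; punchIn; punchOut)
import Data.Fin as Fin
import Data.Fin.Properties as Fin
open import Data.List.Base
  using (List; []; _∷_; length; filter; allFin; concat; map; take; drop; _++_)
import Data.List.Properties as List
open import Data.List.Membership.Propositional using (_∈_; _∉_; lose)
open import Data.List.Membership.Propositional.Properties
  using (∈-filter⁺; ∈-filter⁻; ∈-map⁺; ∈-map⁻; ∈-length; ∈-allFin; ∈-cartesianProductWith⁺)
open import Data.List.Membership.Propositional.Properties.WithK using (unique∧set⇒bag)
open import Data.List.Relation.Binary.BagAndSetEquality using (∼bag⇒↭)
open import Data.List.Relation.Binary.Permutation.Propositional.Properties using (↭-length)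
open import Data.List.Relation.Binary.Prefix.Heterogeneous using ([]; _∷_)
open import Data.List.Relation.Unary.All using (All; []; _∷_)
import Data.List.Relation.Unary.All as All
import Data.List.Relation.Unary.All.Properties as All
open import Data.List.Relation.Unary.AllPairs using (AllPairs; []; _∷_)
import Data.List.Relation.Unary.AllPairs as AllPairs
import Data.List.Relation.Unary.AllPairs.Properties as AllPairs
open import Data.List.Relation.Unary.Any using (here; there; any?; satisfied)
open import Data.List.Relation.Unary.Linked using (Linked; []; [-]; _∷_)
open import Data.List.Relation.Unary.Linked.Properties using (AllPairs⇒Linked)
open import Data.List.Relation.Unary.Unique.Propositional using (Unique)
import Data.List.Relation.Unary.Unique.Propositional.Properties as Unique
open import Data.Product using (∃-syntax; _×_; _,_; proj₁; proj₂)
open import Data.Sum using (_⊎_; inj₁; inj₂)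
open import Data.Vec using (Vec; []; _∷_; lookup; toList; fromList; insertAt; removeAt)
import Data.Vec as Vec
import Data.Vec.Properties as Vec
import Data.Vec.Membership.Propositional.Properties as Vec
open import Function using (_∘_)
open import Function.Bundles using (mk⇔)
open import Relation.Binary.PropositionalEquality
open import Relation.Nullary using (¬_; Dec; yes; no; contradiction)
open import Relation.Nullary.Decidable using (_×-dec_; map′; decidable-stable)

private variable
  m n : ℕ

-- Multiplicities of letters in words.

count : Fin m → List (Fin m) → ℕ
count i xs = length (filter (i Fin.≟_) xs)

lookup-content : (xs : List (Fin m)) (i : Fin m) → lookup (content xs) i ≡ count i xs
lookup-content xs = Vec.lookup∘tabulate λ i → count i xs

lookup-extensional : {A : Set} (xs ys : Vec A n) → (∀ i → lookup xs i ≡ lookup ys i) → xs ≡ ys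
lookup-extensional xs ys eq =
  trans (sym (Vec.tabulate∘lookup xs)) (trans (Vec.tabulate-cong eq) (Vec.tabulate∘lookup ys))

∈⇒count>0 : ∀ {i : Fin m} {xs} → i ∈ xs → 0 < count i xs
∈⇒count>0 {i = i} i∈xs = ∈-length (∈-filter⁺ (i Fin.≟_) i∈xs refl)

∉⇒count≡0 : ∀ {i : Fin m} {xs} → i ∉ xs → count i xs ≡ 0
∉⇒count≡0 {i = i} {xs} i∉xs =
  cong length (List.filter-none (i Fin.≟_) (All.tabulate λ x∈xs → λ { refl → i∉xs x∈xs }))

count≢0⇒∈ : ∀ {i : Fin m} {xs} → ¬ count i xs ≡ 0 → i ∈ xs
count≢0⇒∈ {i = i} {xs} c≢0 = decidable-stable (any? (i Fin.≟_) xs) (c≢0 ∘ ∉⇒count≡0)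

count-∷-≥ : ∀ (i : Fin m) x xs → count i xs ≤ count i (x ∷ xs)
count-∷-≥ i x xs with i Fin.≟ x
... | yes _ = n≤1+n _
... | no  _ = ≤-refl

count-∷-≡ : ∀ (x : Fin m) xs → count x (x ∷ xs) ≡ suc (count x xs)
count-∷-≡ x xs = cong length (List.filter-accept (x Fin.≟_) {x} {xs} refl)

-- The letters counted form a sublist that is both duplicate-free and constant, so it has at most
-- one element.
Unique⇒count≤1 : ∀ {xs : List (Fin m)} → Unique xs → ∀ i → count i xs ≤ 1
Unique⇒count≤1 {xs = xs} xs! i =
  length≤1 (Unique.filter⁺ (i Fin.≟_) xs!) (All.all-filter (i Fin.≟_) xs)
  where
  length≤1 : ∀ {ys} → Unique ys → All (i ≡_) ys → length ys ≤ 1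
  length≤1 []                  _                 = ℕ.z≤n
  length≤1 (_ ∷ [])            _                 = ≤-refl
  length≤1 ((x≢y ∷ _) ∷ _ ∷ _) (refl ∷ refl ∷ _) = contradiction refl x≢y

-- If the head recurred in the tail, it would be counted at least twice. This turns a bound on
-- exponents into injectivity of a coloring.
count≤1⇒lookup-injective : (κ : Vec (Fin m) n) → (∀ i → count i (toList κ) ≤ 1) →
                           ∀ u v → lookup κ u ≡ lookup κ v → u ≡ v
count≤1⇒lookup-injective (x ∷ κ) c≤1 = go
  where
  x∉κ : x ∉ toList κ
  x∉κ x∈κ = 1+n≰n (≤-trans (s≤s (∈⇒count>0 x∈κ))
                   (≤-trans (≤-reflexive (sym (count-∷-≡ x (toList κ)))) (c≤1 x)))
  go : ∀ u v → lookup (x ∷ κ) u ≡ lookup (x ∷ κ) v → u ≡ v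
  go zero    zero    _    = refl
  go zero    (suc v) refl = contradiction (Vec.∈-toList⁺ (Vec.∈-lookup v κ)) x∉κ
  go (suc u) zero    refl = contradiction (Vec.∈-toList⁺ (Vec.∈-lookup u κ)) x∉κ
  go (suc u) (suc v) eq   = cong suc (count≤1⇒lookup-injective κ
    (λ i → ≤-trans (count-∷-≥ i x (toList κ)) (c≤1 i)) u v eq)

-- Enumerations of words and fillings.

words-unique : ∀ m k → Unique (words m k)
words-unique m zero    = [] ∷ []
words-unique m (suc k) =
  Unique.cartesianProductWith⁺ _∷_ Vec.∷-injective (Unique.allFin⁺ m) (words-unique m k)

∈-words : ∀ {k} (w : Vec (Fin m) k) → w ∈ words m k
∈-words []      = here refl
∈-words (i ∷ w) = ∈-cartesianProductWith⁺ _∷_ (∈-allFin i) (∈-words w)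

∈-fillings : (T : Filling m) → T ∈ fillings m (map length T)
∈-fillings []      = here refl
∈-fillings (w ∷ T) =
  -- `fillings` produces each row as `toList` of a vector, so membership is first obtained for the
  -- row `toList (fromList w)`.
  subst (λ w′ → w′ ∷ T ∈ fillings _ (map length (w ∷ T))) (Vec.toList∘fromList w)
    (∈-cartesianProductWith⁺ (λ w T → toList w ∷ T) (∈-words (fromList w)) (∈-fillings T))

-- The squarefree coefficients of chromatic symmetric functions.

-- The exponent vector (1, …, 1) of x₁⋯x_d.
allOnes : ∀ d → Vec ℕ d
allOnes d = content (allFin d)

-- A coloring with this content repeats no color, so adjacent vertices of equal color would coincide
-- and give a loop.
allOnes⇒Proper : (G : Graph n) (κ : Vec (Fin m) n) → HasContent (allOnes m) (toList κ) → Proper G κ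
allOnes⇒Proper {m = m} G κ ones u v uv κu≡κv =
  Graph.loopless G v (subst (λ w → Graph.Adj G w v) (count≤1⇒lookup-injective κ count≤1 u v κu≡κv) uv)
  where
  count≤1 : ∀ i → count i (toList κ) ≤ 1
  count≤1 i = subst (_≤ 1)
    (trans (sym (lookup-content (allFin m) i))
           (trans (cong (λ α → lookup α i) (sym ones)) (lookup-content (toList κ) i)))
    (Unique⇒count≤1 (Unique.allFin⁺ m) i)

contributes? : (G : Graph n) (α : Vec ℕ m) (κ : Vec (Fin m) n) →
               Dec (Proper G κ × HasContent α (toList κ))
contributes? G α κ = proper? G κ ×-dec hasContent? α (toList κ)

-- For either graph the filter selects exactly the words of content `allOnes d`, since this content
-- already makes a coloring proper.
X-allOnes : (G H : Graph n) → ∀ d → X G d (allOnes d) ≡ X H d (allOnes d)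
X-allOnes {n} G H d = cong (λ l → + length l / 1)
  (List.filter-≐ (contributes? G (allOnes d)) (contributes? H (allOnes d))
    ((λ {κ} (_ , ones) → allOnes⇒Proper H κ ones , ones) ,
     (λ {κ} (_ , ones) → allOnes⇒Proper G κ ones , ones))
    (words d n))

-- Filling the rows one after the other gives a standard tableau.

module _ {A : Set} where

  chop : List ℕ → List A → List (List A)
  chop []       xs = []
  chop (r ∷ rs) xs = take r xs ∷ chop rs (drop r xs)

  length-drop-sum : ∀ r rs {xs : List A} → length xs ≡ sum (r ∷ rs) → length (drop r xs) ≡ sum rs
  length-drop-sum r rs {xs} eq =
    trans (List.length-drop r xs) (trans (cong (ℕ._∸ r) eq) (m+n∸m≡n r (sum rs)))

  length-take-sum : ∀ r rs {xs : List A} → length xs ≡ sum (r ∷ rs) → length (take r xs) ≡ r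
  length-take-sum r rs {xs} eq = trans (List.length-take r xs)
    (m≤n⇒m⊓n≡m (≤-trans (m≤m+n r (sum rs)) (≤-reflexive (sym eq))))

  concat-chop : ∀ rs {xs} → length xs ≡ sum rs → concat (chop rs xs) ≡ xs
  concat-chop []       {[]} eq = refl
  concat-chop (r ∷ rs) {xs} eq =
    trans (cong (take r xs ++_) (concat-chop rs (length-drop-sum r rs eq)))
          (List.take++drop≡id r xs)

  map-length-chop : ∀ rs {xs} → length xs ≡ sum rs → map length (chop rs xs) ≡ rs
  map-length-chop []       eq = refl
  map-length-chop (r ∷ rs) eq =
    cong₂ _∷_ (length-take-sum r rs eq) (map-length-chop rs (length-drop-sum r rs eq))

  -- Used for the column condition: in an increasing list, each entry of a row is smaller than
  -- everything placed in later rows.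
  take-drop-AllPairs : ∀ {R : A → A → Set} n {xs} → AllPairs R xs →
                       All (λ x → All (R x) (drop n xs)) (take n xs)
  take-drop-AllPairs zero    _          = []
  take-drop-AllPairs (suc n) []         = []
  take-drop-AllPairs (suc n) (px ∷ pxs) = All.drop⁺ n px ∷ take-drop-AllPairs n pxs

-- When every upper entry is below every lower entry in value, only the row lengths remain to be
-- compared.
above : ∀ {upper lower : List (Fin m)} → length lower ≤ length upper →
        All (λ i → All (i Fin.<_) lower) upper → upper Above lower
above {lower = []}                    _         _                    = []
above {upper = _ ∷ _} {lower = _ ∷ _} (s≤s len) ((i<j ∷ _) ∷ i<lower) =
  i<j ∷ above len (All.map All.tail i<lower)

chop-rows : ∀ rs {xs : List (Fin m)} → AllPairs Fin._<_ xs → All (Linked Fin._≤_) (chop rs xs)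
chop-rows []       _  = []
chop-rows (r ∷ rs) xs↗ =
  AllPairs⇒Linked (AllPairs.map <⇒≤ (AllPairs.take⁺ r xs↗)) ∷ chop-rows rs (AllPairs.drop⁺ r xs↗)

chop-columns : ∀ {rs} {xs : List (Fin m)} → Linked _≥_ rs → length xs ≡ sum rs →
               AllPairs Fin._<_ xs → Linked _Above_ (chop rs xs)
chop-columns []  _ _ = []
chop-columns [-] _ _ = [-]
chop-columns {rs = r ∷ r′ ∷ rs} {xs} (r≥r′ ∷ rs↘) eq xs↗ =
  above (subst₂ _≤_ (sym (length-take-sum r′ rs eq′)) (sym (length-take-sum r (r′ ∷ rs) eq)) r≥r′)
        -- The second row is an initial segment of `drop r xs`.
        (All.map (All.take⁺ r′) (take-drop-AllPairs r xs↗))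
  ∷ chop-columns rs↘ eq′ (AllPairs.drop⁺ r xs↗)
  where
  eq′ : length (drop r xs) ≡ sum (r′ ∷ rs)
  eq′ = length-drop-sum r (r′ ∷ rs) eq

-- Vanishing of coefficients in a non-negative Schur expansion.

size : Partition → ℕ
size p = sum (Partition.parts p)

tableau? : (α : Vec ℕ m) (T : Filling m) → Dec (SemiStandard T × HasContent α (concat T))
tableau? α T = semiStandard? T ×-dec hasContent? α (concat T)

schur-nonNegative : ∀ p m α → ℚ.NonNegative (schur p m α)
schur-nonNegative p m α =
  ℚ.normalize-nonNeg (length (filter (tableau? α) (fillings m (Partition.parts p)))) 1

-- The shape filled row by row with the `d` letters in increasing order is one of the tableaux
-- counted, so the count is nonzero.
schur-allOnes-positive : ∀ p → ℚ.Positive (schur p (size p) (allOnes (size p)))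
schur-allOnes-positive p =
  ℚ.normalize-pos (length (filter ones? (fillings d parts))) 1
    {{_}} {{ℕ.>-nonZero (∈-length (∈-filter⁺ ones? T∈fillings T-tableau))}}
  where
  open Partition p
  d = size p
  ones? = tableau? (allOnes d)
  T : Filling d
  T = chop parts (allFin d)
  eq : length (allFin d) ≡ d
  eq = List.length-tabulate _
  T∈fillings : T ∈ fillings d parts
  -- `T` is listed among the fillings with its own row lengths, and these are `parts`.
  T∈fillings = subst (λ rs → T ∈ fillings d rs) (map-length-chop parts eq) (∈-fillings T)
  xs↗ : AllPairs Fin._<_ (allFin d)
  xs↗ = AllPairs.tabulate⁺-< λ i<j → i<j
  T-tableau : SemiStandard T × HasContent (allOnes d) (concat T)
  T-tableau = (chop-rows parts xs↗ , chop-columns decreasing eq xs↗) , cong content (concat-chop parts eq)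

p≤p+q : ∀ p q .{{_ : ℚ.NonNegative q}} → p ℚ.≤ p ℚ.+ q
p≤p+q p q = subst (ℚ._≤ p ℚ.+ q) (ℚ.+-identityʳ p) (ℚ.+-monoʳ-≤ p (ℚ.nonNegative⁻¹ q))

p≤q+p : ∀ p q .{{_ : ℚ.NonNegative q}} → p ℚ.≤ q ℚ.+ p
p≤q+p p q = subst (p ℚ.≤_) (ℚ.+-comm p q) (p≤p+q p q)

NonNegativeCoefficients : List (ℚ × Partition) → Set
NonNegativeCoefficients = All λ (c , _) → 0ℚ ℚ.≤ c

summand-nonNegative : ∀ {c} p m α → 0ℚ ℚ.≤ c → ℚ.NonNegative ((c ·ₛ schur p) m α)
summand-nonNegative {c} p m α 0≤c =
  ℚ.nonNeg*nonNeg⇒nonNeg c {{ℚ.nonNegative 0≤c}} (schur p m α) {{schur-nonNegative p m α}}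

combination-nonNegative : ∀ {cs} → NonNegativeCoefficients cs → ∀ m α →
                          ℚ.NonNegative (schurCombination cs m α)
combination-nonNegative []                              m α = _
combination-nonNegative (_∷_ {c , p} {cs} 0≤c 0≤cs) m α =
  ℚ.nonNeg+nonNeg⇒nonNeg ((c ·ₛ schur p) m α) {{summand-nonNegative p m α 0≤c}}
    (schurCombination cs m α) {{combination-nonNegative 0≤cs m α}}

-- All other summands have non-negative coefficients, so omitting them cannot increase the value.
summand≤combination : ∀ {cs c p} → NonNegativeCoefficients cs → (c , p) ∈ cs → ∀ m α →
                      (c ·ₛ schur p) m α ℚ.≤ schurCombination cs m α
summand≤combination {_ ∷ cs} {c} {p} (_ ∷ 0≤cs) (here refl) m α =
  p≤p+q ((c ·ₛ schur p) m α) (schurCombination cs m α) {{combination-nonNegative 0≤cs m α}}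
summand≤combination {(b , q) ∷ cs} (0≤b ∷ 0≤cs) (there cp∈cs) m α =
  ℚ.≤-trans (summand≤combination 0≤cs cp∈cs m α)
    (p≤q+p (schurCombination cs m α) ((b ·ₛ schur q) m α) {{summand-nonNegative q m α 0≤b}})

zeroCombination : ∀ {cs} → All (λ (c , _) → c ≡ 0ℚ) cs → schurCombination cs ≈ₛ 0ₛ
zeroCombination []                      m α = refl
zeroCombination (_∷_ {_ , p} refl cs≡0) m α =
  cong₂ ℚ._+_ (ℚ.*-zeroˡ (schur p m α)) (zeroCombination cs≡0 m α)

-- Each term `(c , p)` is tested at `allOnes (size p)`: there `c` times the positive number `s` is
-- at most the coefficient of `F`, which is 0, so `c` is at most 0. The vanishing is assumed for
-- every `d` because the terms may have partitions of different sizes.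
schurPositive∧allOnes≡0⇒≈0 : ∀ {F} → (∀ d → F d (allOnes d) ≡ 0ℚ) → SchurPositive F → F ≈ₛ 0ₛ
schurPositive∧allOnes≡0⇒≈0 {F} ones≡0 (cs , 0≤cs , F≈cs) m α =
  trans (F≈cs m α) (zeroCombination (All.tabulate c≡0) m α)
  where
  c≡0 : ∀ {cp} → cp ∈ cs → proj₁ cp ≡ 0ℚ
  c≡0 {c , p} cp∈cs = ℚ.≤-antisym
    (ℚ.*-cancelʳ-≤-pos s {{schur-allOnes-positive p}} (begin
      c ℚ.* s                              ≤⟨ summand≤combination 0≤cs cp∈cs d (allOnes d) ⟩
      schurCombination cs d (allOnes d)    ≡⟨ sym (F≈cs d (allOnes d)) ⟩
      F d (allOnes d)                      ≡⟨ ones≡0 d ⟩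
      0ℚ                                   ≡⟨ sym (ℚ.*-zeroˡ s) ⟩
      0ℚ ℚ.* s                             ∎))
    (All.lookup 0≤cs cp∈cs)
    where
    open ℚ.≤-Reasoning
    d = size p
    s = schur p d (allOnes d)

-- Deleting an unused variable.

∉-map-punchIn : ∀ (i : Fin (suc m)) (κ : Vec (Fin m) n) → i ∉ toList (Vec.map (punchIn i) κ)
∉-map-punchIn i (x ∷ κ) (here i≡)  = Fin.punchInᵢ≢i i x (sym i≡)
∉-map-punchIn i (x ∷ κ) (there i∈) = ∉-map-punchIn i κ i∈

count-map-punchIn : ∀ (i : Fin (suc m)) j (κ : Vec (Fin m) n) →
                    count (punchIn i j) (toList (Vec.map (punchIn i) κ)) ≡ count j (toList κ)
count-map-punchIn i j []      = refl
count-map-punchIn i j (x ∷ κ) with j Fin.≟ x | punchIn i j Fin.≟ punchIn i x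
... | yes _   | yes _ = cong suc (count-map-punchIn i j κ)
... | yes j≡x | no ≢  = contradiction (cong (punchIn i) j≡x) ≢
... | no j≢x  | yes ≡ = contradiction (Fin.punchIn-injective i j x ≡) j≢x
... | no _    | no _  = count-map-punchIn i j κ

content-map-punchIn : ∀ (i : Fin (suc m)) (κ : Vec (Fin m) n) →
                      content (toList (Vec.map (punchIn i) κ)) ≡ insertAt (content (toList κ)) i 0
content-map-punchIn i κ = lookup-extensional _ _ λ j → trans (lookup-content κ′ j) (at j)
  where
  κ′ = toList (Vec.map (punchIn i) κ)
  β  = content (toList κ)
  at : ∀ j → count j κ′ ≡ lookup (insertAt β i 0) j
  at j with i Fin.≟ j
  ... | yes refl = trans (∉⇒count≡0 (∉-map-punchIn i κ)) (sym (Vec.insertAt-lookup β i 0))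
  -- Every index other than `i` is `punchIn i k` for some `k`, and there both sides reduce to the
  -- exponent of `k` in `β`.
  ... | no i≢j   = subst (λ j → count j κ′ ≡ lookup (insertAt β i 0) j) (Fin.punchIn-punchOut i≢j)
    (begin
      count (punchIn i k) κ′                ≡⟨ count-map-punchIn i k κ ⟩
      count k (toList κ)                    ≡⟨ sym (lookup-content (toList κ) k) ⟩
      lookup β k                            ≡⟨ sym (Vec.insertAt-punchIn β i 0 k) ⟩
      lookup (insertAt β i 0) (punchIn i k) ∎)
    where
    open ≡-Reasoning
    k = punchOut i≢j

-- The range of `punchIn i` consists of all letters but `i`, so `punchOut` gives a preimage letter
-- by letter.
∉⇒map-punchIn : ∀ {i : Fin (suc m)} (κ : Vec (Fin (suc m)) n) → i ∉ toList κ →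
                ∃[ κ₀ ] κ ≡ Vec.map (punchIn i) κ₀
∉⇒map-punchIn []      _   = [] , refl
∉⇒map-punchIn (x ∷ κ) i∉ with ∉⇒map-punchIn κ (i∉ ∘ there)
... | κ₀ , eq = punchOut (i∉ ∘ here) ∷ κ₀ , cong₂ _∷_ (sym (Fin.punchIn-punchOut (i∉ ∘ here))) eq

insertAt-injective : ∀ {A : Set} (xs ys : Vec A n) i {x} → insertAt xs i x ≡ insertAt ys i x → xs ≡ ys
insertAt-injective xs ys i {x} eq =
  trans (sym (Vec.removeAt-insertAt xs i x))
        (trans (cong (λ zs → removeAt zs i) eq) (Vec.removeAt-insertAt ys i x))

Vec-map-injective : ∀ {A B : Set} {f : A → B} → (∀ {x y} → f x ≡ f y → x ≡ y) →
                    {xs ys : Vec A n} → Vec.map f xs ≡ Vec.map f ys → xs ≡ ys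
Vec-map-injective inj {[]}     {[]}     _  = refl
Vec-map-injective inj {x ∷ xs} {y ∷ ys} eq =
  cong₂ _∷_ (inj (Vec.∷-injectiveˡ eq)) (Vec-map-injective inj (Vec.∷-injectiveʳ eq))

Proper-map-punchIn⁺ : (G : Graph n) (i : Fin (suc m)) (κ : Vec (Fin m) n) →
                      Proper G κ → Proper G (Vec.map (punchIn i) κ)
Proper-map-punchIn⁺ G i κ κ-proper u v uv eq = κ-proper u v uv (Fin.punchIn-injective i _ _
  (trans (sym (Vec.lookup-map u (punchIn i) κ)) (trans eq (Vec.lookup-map v (punchIn i) κ))))

Proper-map-punchIn⁻ : (G : Graph n) (i : Fin (suc m)) (κ : Vec (Fin m) n) →
                      Proper G (Vec.map (punchIn i) κ) → Proper G κ
Proper-map-punchIn⁻ G i κ κ-proper u v uv eq = κ-proper u v uv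
  (trans (Vec.lookup-map u (punchIn i) κ)
         (trans (cong (punchIn i) eq) (sym (Vec.lookup-map v (punchIn i) κ))))

X-insertAt : (G : Graph n) (β : Vec ℕ m) (i : Fin (suc m)) →
             X G (suc m) (insertAt β i 0) ≡ X G m β
X-insertAt {n} {m} G β i = cong (λ l → + l / 1)
  (trans (↭-length (∼bag⇒↭ (unique∧set⇒bag
            (Unique.filter⁺ large? (words-unique (suc m) n))
            (Unique.map⁺ (Vec-map-injective (Fin.punchIn-injective i _ _))
                         (Unique.filter⁺ small? (words-unique m n)))
            (mk⇔ to from))))
         (List.length-map extend (filter small? (words m n))))
  where
  large? = contributes? G (insertAt β i 0)
  small? = contributes? G β
  extend : Vec (Fin m) n → Vec (Fin (suc m)) n
  extend = Vec.map (punchIn i)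

  to : ∀ {κ} → κ ∈ filter large? (words (suc m) n) → κ ∈ map extend (filter small? (words m n))
  to {κ} κ∈ with proj₂ (∈-filter⁻ large? {xs = words (suc m) n} κ∈)
  ... | κ-proper , κ-content with ∉⇒map-punchIn {i = i} κ i∉κ
    where
    i∉κ : i ∉ toList κ
    -- An occurrence of `i` would make its exponent positive, but the inserted exponent is 0.
    i∉κ i∈κ = n>0⇒n≢0 (∈⇒count>0 i∈κ)
      (trans (sym (lookup-content (toList κ) i))
             (trans (cong (λ α → lookup α i) κ-content) (Vec.insertAt-lookup β i 0)))
  ... | κ₀ , refl = ∈-map⁺ extend (∈-filter⁺ small? (∈-words κ₀)
    (Proper-map-punchIn⁻ G i κ₀ κ-proper ,
     insertAt-injective _ _ i (trans (sym (content-map-punchIn i κ₀)) κ-content)))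

  from : ∀ {κ} → κ ∈ map extend (filter small? (words m n)) → κ ∈ filter large? (words (suc m) n)
  from κ∈ with ∈-map⁻ extend κ∈
  ... | κ₀ , κ₀∈ , refl with proj₂ (∈-filter⁻ small? {xs = words m n} κ₀∈)
  ... | κ₀-proper , κ₀-content = ∈-filter⁺ large? (∈-words (extend κ₀))
    (Proper-map-punchIn⁺ G i κ₀ κ₀-proper ,
     trans (content-map-punchIn i κ₀) (cong (λ β → insertAt β i 0) κ₀-content))

-- Reduction to finitely many coefficients.

X-noContent : (G : Graph n) (α : Vec ℕ m) → (∀ (κ : Vec (Fin m) n) → ¬ HasContent α (toList κ)) →
              X G m α ≡ 0ℚ
X-noContent {n} {m} G α none = cong (λ l → + length l / 1)
  (List.filter-none (contributes? G α) (All.universal (λ κ → none κ ∘ proj₂) (words m n)))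

-- Choosing for each letter a position where it occurs is injective, because the letter can be read
-- off from the position.
surjective⇒≤ : (κ : Vec (Fin m) n) → (∀ i → i ∈ toList κ) → m ≤ n
surjective⇒≤ {m} {n} κ all∈ = Fin.injective⇒≤ {f = position} λ {i} {j} eq →
  trans (at-position i) (trans (cong (lookup κ) eq) (sym (at-position j)))
  where
  open import Data.Vec.Relation.Unary.Any using (index)
  open import Data.Vec.Relation.Unary.Any.Properties using (lookup-index)
  position : Fin m → Fin n
  position i = index (Vec.∈-toList⁻ (all∈ i))
  at-position : ∀ i → i ≡ lookup κ (position i)
  at-position i = lookup-index (Vec.∈-toList⁻ (all∈ i))

unusedVariable : n < m → (κ : Vec (Fin m) n) → ∃[ i ] lookup (content (toList κ)) i ≡ 0
unusedVariable n<m κ with Fin.any? (λ i → lookup (content (toList κ)) i ≟ 0)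
... | yes unused = unused
... | no  ¬unused = contradiction
  (surjective⇒≤ κ λ i → count≢0⇒∈ λ eq → ¬unused (i , trans (lookup-content (toList κ) i) eq))
  (λ m≤n → 1+n≰n (≤-trans n<m m≤n))

module _ {n} (F : PowerSeries)
  (noContent⇒0 : ∀ {m} α → (∀ (κ : Vec (Fin m) n) → ¬ HasContent α (toList κ)) → F m α ≡ 0ℚ)
  (F-insertAt : ∀ {m} (β : Vec ℕ m) i → F (suc m) (insertAt β i 0) ≡ F m β)
  where

  -- Contents of words of length `n` run through the exponent vectors of degree `n`, possibly with
  -- repetition, which makes the quantification finite.
  VanishesUpTo : ℕ → Set
  VanishesUpTo b = ∀ {m} → m < b → All (λ κ → F m (content (toList κ)) ≡ 0ℚ) (words m n)

  vanishesUpTo? : ∀ b → Dec (VanishesUpTo b)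
  vanishesUpTo? = allUpTo? λ m → All.all? (λ κ → F m (content (toList κ)) ℚ.≟ 0ℚ) (words m n)

  vanishesUpTo⇒≈0 : VanishesUpTo (suc n) → F ≈ₛ 0ₛ
  vanishesUpTo⇒≈0 vanish m α with any? (λ κ → hasContent? α (toList κ)) (words m n)
  ... | no none = noContent⇒0 α λ κ κ-content → none (lose (∈-words κ) κ-content)
  ... | yes some with satisfied some | m ≤? n
  ...   | κ , refl | yes m≤n = All.lookup (vanish (s≤s m≤n)) (∈-words κ)
  vanishesUpTo⇒≈0 vanish zero    α | yes some | κ , refl | no m≰n = contradiction ℕ.z≤n m≰n
  vanishesUpTo⇒≈0 vanish (suc m) α | yes some | κ , refl | no m≰n
    with unusedVariable (≰⇒> m≰n) κ
  ... | i , αᵢ≡0 = begin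
    -- Since the exponent at `i` is 0, removing it and inserting 0 restores `α`.
    F (suc m) α                 ≡⟨ cong (F (suc m)) (trans (sym (Vec.insertAt-removeAt α i))
                                                           (cong (insertAt β i) αᵢ≡0)) ⟩
    F (suc m) (insertAt β i 0)  ≡⟨ F-insertAt β i ⟩
    F m β                       ≡⟨ vanishesUpTo⇒≈0 vanish m β ⟩
    0ℚ                          ∎
    where
    open ≡-Reasoning
    β = removeAt α i

  ≈0? : Dec (F ≈ₛ 0ₛ)
  ≈0? = map′ vanishesUpTo⇒≈0 (λ F≈0 {m} _ → All.universal (λ κ → F≈0 m _) (words m n))
             (vanishesUpTo? (suc n))

-- Differences of chromatic symmetric functions.

difference≈0? : (G H : Graph n) → Dec (X G -ₛ X H ≈ₛ 0ₛ)
difference≈0? G H = ≈0? (X G -ₛ X H)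
  -- `0ℚ ℚ.- 0ℚ` computes to `0ℚ`.
  (λ α none → cong₂ ℚ._-_ (X-noContent G α none) (X-noContent H α none))
  (λ β i → cong₂ ℚ._-_ (X-insertAt G β i) (X-insertAt H β i))

difference-allOnes : (G H : Graph n) → ∀ d → (X G -ₛ X H) d (allOnes d) ≡ 0ℚ
difference-allOnes G H d =
  trans (cong (ℚ._- X H d (allOnes d)) (X-allOnes G H d)) (ℚ.+-inverseʳ (X H d (allOnes d)))

theorem2p15 : ∀ (n : ℕ) (G H : Graph n) → Connected G → Connected H →
    (X G -ₛ X H ≈ₛ 0ₛ) ⊎ (¬ SchurPositive (X G -ₛ X H))
theorem2p15 n G H _ _ =
  dichotomy (X G -ₛ X H) (difference≈0? G H) (difference-allOnes G H)
  where
  dichotomy : ∀ F → Dec (F ≈ₛ 0ₛ) → (∀ d → F d (allOnes d) ≡ 0ℚ) → (F ≈ₛ 0ₛ) ⊎ (¬ SchurPositive F)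
  dichotomy F (yes F≈0) _      = inj₁ F≈0
  dichotomy F (no  F≉0) ones≡0 = inj₂ (F≉0 ∘ schurPositive∧allOnes≡0⇒≈0 {F} ones≡0)
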